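{- Let $0<\beta<\frac13$ and let $S\subset\mathbb{R}$ be a Bernstein set. Then McMullen's absolute winning game with parameter $\beta$ and target set $S$ is not determined, i.e., neither Alice nor Bob has a winning strategy.
   Context: A Bernstein set is a set $S\subset\mathbb{R}$ that has nonempty intersection with every closed uncountable subset of $\mathbb{R}$ but contains no closed uncountable subset of $\mathbb{R}$. McMullen's absolute winning game with parameter $0<\beta<\frac13$ and target set $S$: Bob first chooses a compact interval $B_0$ of positive length. Alice then chooses an interval $A_0\subset B_0$ with $|A_0|=\beta|B_0|$. Bob then chooses a compact interval $B_1\subset B_0\setminus A_0$ with $|B_1|=\beta|B_0|$, and so on: for every $n\ge0$, $A_n\subset B_n$ with $|A_n|=\beta|B_n|$, and $B_{n+1}\subset B_n\setminus A_n$ with $|B_{n+1}|=\beta|B_n|$. Alice wins if $\bigcap_{n\ge0}B_n$ has nonempty intersection with $S$; otherwise Bob wins. Here $|I|$ denotes the length of an interval $I$. A strategy for a player is a rule specifying a legal move in every possible situation as a function of all previously chosen intervals; it is winning if it guarantees that player wins regardless of the opponent's moves. The game is determined on $S$ if one of the players has a winning strategy, and not determined otherwise. -}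

module Defs where

open import Algebra.Bundles using (CommutativeRing)
open import Data.Bool.Base using (Bool; true; false)
open import Data.List.Base using (List; []; _∷_)
open import Data.List.Relation.Binary.Pointwise.Base using (Pointwise)
open import Data.Nat.Base using (ℕ; zero; suc)
open import Data.Product.Base using (Σ; ∃; _×_; _,_; proj₁)
open import Data.Sum.Base using (_⊎_)
open import Data.Unit.Base using (⊤)
open import Function.Bundles using (Injection)
open import Level using (0ℓ)
open import Relation.Binary.Bundles using (Setoid)
open import Relation.Binary.Core using (Rel)
open import Relation.Binary.Definitions using (_Respects_)
open import Relation.Binary.PropositionalEquality using (_≡_; setoid)
open import Relation.Binary.Structures using (IsTotalOrder)
open import Relation.Nullary.Negation using (¬_)
open import Relation.Unary
  using (Pred; _∈_; _∉_; _⊆_; _∖_; _≬_; Satisfiable; ⋂)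

import Relation.Binary.Construct.NonStrictToStrict as ToStrict
import Relation.Binary.Construct.On as On

-- The real line is axiomatised as a Dedekind-complete ordered field, which is
-- unique up to isomorphism.  Assuming excluded middle, the Cauchy reals form
-- a model.  The value of 0# ⁻¹ is unspecified.

record CompleteOrderedField : Set₁ where
  infix 4 _≤_ _<_
  infix 8 _⁻¹

  field
    commutativeRing : CommutativeRing 0ℓ 0ℓ

  open CommutativeRing commutativeRing public

  field
    0≉1         : ¬ 0# ≈ 1#
    _⁻¹         : Carrier → Carrier
    ⁻¹-cong     : ∀ {x y} → x ≈ y → x ⁻¹ ≈ y ⁻¹
    ⁻¹-inverseʳ : ∀ x → ¬ x ≈ 0# → x * x ⁻¹ ≈ 1#

    _≤_          : Rel Carrier 0ℓ
    isTotalOrder : IsTotalOrder _≈_ _≤_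
    +-monoʳ-≤    : ∀ x {y z} → y ≤ z → x + y ≤ x + z
    *-nonneg     : ∀ {x y} → 0# ≤ x → 0# ≤ y → 0# ≤ x * y

  _<_ : Rel Carrier 0ℓ
  _<_ = ToStrict._<_ _≈_ _≤_

  UpperBound : Pred Carrier 0ℓ → Pred Carrier 0ℓ
  UpperBound P u = ∀ x → x ∈ P → x ≤ u

  field
    complete : (P : Pred Carrier 0ℓ) →
               Satisfiable P → Satisfiable (UpperBound P) →
               ∃ λ s → s ∈ UpperBound P × (∀ u → u ∈ UpperBound P → s ≤ u)

module RealLine (R : CompleteOrderedField) where

  open CompleteOrderedField R renaming (Carrier to ℝ; setoid to ℝ-setoid)

  record Subset : Set₁ where
    field
      member   : Pred ℝ 0ℓ
      respects : member Respects _≈_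

  open Subset public

  Closed : Subset → Set
  Closed C = ∀ x → x ∉ member C →
             ∃ λ ε → 0# < ε ×
               (∀ y → x - ε < y → y < x + ε → y ∉ member C)

  subsetSetoid : Subset → Setoid 0ℓ 0ℓ
  subsetSetoid C = On.setoid {B = Σ ℝ (member C)} ℝ-setoid proj₁

  Countable : Subset → Set
  Countable C = Injection (subsetSetoid C) (setoid ℕ)

  Uncountable : Subset → Set
  Uncountable C = ¬ Countable C

  record Bernstein (S : Subset) : Set₁ where
    field
      meets        : ∀ C → Closed C → Uncountable C → member S ≬ member C
      containsNone : ∀ C → Closed C → Uncountable C → ¬ (member C ⊆ member S)

  record CompactInterval : Set where
    field
      lo hi : ℝ
      lo<hi : lo < hi

  -- A bounded interval of positive length, of any of the four types: its
  -- closure, together with flags telling which endpoints belong to it.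

  record Interval : Set where
    field
      closure    : CompactInterval
      leftClosed rightClosed : Bool

  open CompactInterval public
  open Interval public

  length : CompactInterval → ℝ
  length I = hi I - lo I

  below : Bool → Rel ℝ 0ℓ
  below true  = _≤_
  below false = _<_

  ⟦_⟧ᶜ : CompactInterval → Pred ℝ 0ℓ
  ⟦ B ⟧ᶜ x = lo B ≤ x × x ≤ hi B

  ⟦_⟧ : Interval → Pred ℝ 0ℓ
  ⟦ A ⟧ x = below (leftClosed A) (lo (closure A)) x ×
            below (rightClosed A) x (hi (closure A))

  infix 4 _≈ᶜ_ _≈ⁱ_

  _≈ᶜ_ : Rel CompactInterval 0ℓ
  B ≈ᶜ B′ = lo B ≈ lo B′ × hi B ≈ hi B′

  _≈ⁱ_ : Rel Interval 0ℓ
  A ≈ⁱ A′ = closure A ≈ᶜ closure A′ ×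
            leftClosed A ≡ leftClosed A′ × rightClosed A ≡ rightClosed A′

module AbsoluteGame (R : CompleteOrderedField)
                    (β : CompleteOrderedField.Carrier R)
                    (S : RealLine.Subset R) where

  open CompleteOrderedField R using (_≈_; _*_)
  open RealLine R

  -- A round is Bob's Bₙ followed by Alice's Aₙ; a history lists the completed
  -- rounds, the most recent one first.

  Round : Set
  Round = CompactInterval × Interval

  History : Set
  History = List Round

  _≈ʳ_ : Rel Round 0ℓ
  (B , A) ≈ʳ (B′ , A′) = B ≈ᶜ B′ × A ≈ⁱ A′

  _≈ʰ_ : Rel History 0ℓ
  _≈ʰ_ = Pointwise _≈ʳ_

  BobLegal : History → CompactInterval → Set
  BobLegal []            B′ = ⊤
  BobLegal ((B , A) ∷ _) B′ = ⟦ B′ ⟧ᶜ ⊆ ⟦ B ⟧ᶜ ∖ ⟦ A ⟧ × length B′ ≈ β * length B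

  AliceLegal : CompactInterval → Interval → Set
  AliceLegal B A = ⟦ A ⟧ ⊆ ⟦ B ⟧ᶜ × length (closure A) ≈ β * length B

  Legal : History → Set
  Legal []            = ⊤
  Legal ((B , A) ∷ h) = Legal h × BobLegal h B × AliceLegal B A

  -- Strategies are total functions; their values at illegal situations are
  -- irrelevant.

  record AliceStrategy : Set where
    field
      move  : History → CompactInterval → Interval
      cong  : ∀ {h h′ B B′} → h ≈ʰ h′ → B ≈ᶜ B′ → move h B ≈ⁱ move h′ B′
      legal : ∀ h B → Legal h → BobLegal h B → AliceLegal B (move h B)

  record BobStrategy : Set where
    field
      move  : History → CompactInterval
      cong  : ∀ {h h′} → h ≈ʰ h′ → move h ≈ᶜ move h′
      legal : ∀ h → Legal h → BobLegal h (move h)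

  historyBefore : (ℕ → CompactInterval) → (ℕ → Interval) → ℕ → History
  historyBefore B A zero    = []
  historyBefore B A (suc n) = (B n , A n) ∷ historyBefore B A n

  record Play : Set where
    field
      B : ℕ → CompactInterval
      A : ℕ → Interval

    history : ℕ → History
    history = historyBefore B A

    field
      bobLegal   : ∀ n → BobLegal (history n) (B n)
      aliceLegal : ∀ n → AliceLegal (B n) (A n)

  AliceWins : Play → Set
  AliceWins p = ⋂ ℕ (λ n → ⟦ Play.B p n ⟧ᶜ) ≬ member S

  BobWins : Play → Set
  BobWins p = ¬ AliceWins p

  AliceFollows : AliceStrategy → Play → Set
  AliceFollows σ p = ∀ n → A n ≈ⁱ AliceStrategy.move σ (history n) (B n)
    where open Play p

  BobFollows : BobStrategy → Play → Set
  BobFollows τ p = ∀ n → B n ≈ᶜ BobStrategy.move τ (history n)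
    where open Play p

  AliceHasWinningStrategy : Set
  AliceHasWinningStrategy = ∃ λ σ → ∀ p → AliceFollows σ p → AliceWins p

  BobHasWinningStrategy : Set
  BobHasWinningStrategy = ∃ λ τ → ∀ p → BobFollows τ p → BobWins p

  Determined : Set
  Determined = AliceHasWinningStrategy ⊎ BobHasWinningStrategy

{-# OPTIONS --safe #-}
module Submission where

open import Defs
open import Algebra.Bundles using (CommutativeRing)
open import Axiom.ExcludedMiddle using (ExcludedMiddle)
open import Data.Bool.Base using (Bool; true; false)
open import Data.Empty using (⊥; ⊥-elim)
open import Data.List.Base using ([]; _∷_)
open import Data.Nat.Base as ℕ using (ℕ; zero; suc)
import Data.Nat.Properties as ℕ
open import Data.Product.Base using (Σ; ∃; _×_; _,_; proj₁; proj₂)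
open import Data.Sum.Base using (_⊎_; inj₁; inj₂; [_,_]′)
open import Data.Unit.Base using (tt)
open import Function.Bundles using (Injection)
open import Level using (0ℓ)
open import Relation.Binary.Construct.Closure.Transitive using (TransClosure; [_]; _∷_; _++_)
open import Relation.Binary.Core using (Rel)
open import Relation.Binary.PropositionalEquality as ≡ using (_≡_)
open import Relation.Binary.Structures using (IsTotalOrder)
open import Relation.Nullary.Decidable using (Dec; yes; no)
open import Relation.Nullary.Negation using (¬_)
open import Relation.Unary using (Pred; Satisfiable; _⊆_)

-- If against a fixed winning strategy the opponent can always steer towards
-- either of two disjoint intervals, then the outcomes contain a Cantor set,
-- which is closed, uncountable, and lies inside S (Alice's strategy) or outside
-- S (Bob's strategy); both contradict the Bernstein property.
--
-- Against Bob, Alice obtains the second interval by occupying his reply to her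
-- first move.  Against Alice, a single round need not suffice when β > 1/4.
-- But if Bob could never reach two disjoint intervals, all reachable intervals
-- would share a point x.  Bob's extreme moves show that x always lies within
-- relative distance β of an endpoint, and Bob can shift the next interval by a
-- fixed relative amount; so the relative positions of x that he can arrange
-- would contain arbitrarily long segments, although they lie in [0,1].

-- Ring solver with integer coefficients for an arbitrary commutative ring.

module IntegerSolver {c ℓ} (R : CommutativeRing c ℓ) where

  open CommutativeRing R
  open import Algebra.Bundles.Raw using (RawRing)
  open import Algebra.Properties.AbelianGroup +-abelianGroup using (⁻¹-∙-comm; ε⁻¹≈ε; ⁻¹-involutive)
  open import Algebra.Properties.Ring ring using (-‿distribˡ-*; -‿distribʳ-*)
  open import Algebra.Properties.Semiring.Mult.TCOptimised semiring
    using (×-homo-+; ×1-homo-*; 1+×) renaming (_×_ to _×′_)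
  open import Algebra.Solver.Ring.AlmostCommutativeRing
    using (_-Raw-AlmostCommutative⟶_; fromCommutativeRing)
  open import Data.Integer.Base as ℤ using (ℤ; +_; -[1+_]; _⊖_; _◃_)
  import Data.Integer.Properties as ℤ
  open import Data.Maybe.Base using (Maybe; map)
  open import Data.Sign.Base as Sign using (Sign)
  open import Relation.Binary.Reasoning.Setoid setoid
  open import Relation.Nullary.Decidable using (dec⇒maybe)

  -- With the optimised multiple, `fromℕ 1` reduces to `1#` itself, so `:1` can be matched with `1#`
  -- in the goals given to the solver.
  fromℕ : ℕ → Carrier
  fromℕ n = n ×′ 1#

  fromℤ : ℤ → Carrier
  fromℤ (+ n)    = fromℕ n
  fromℤ -[1+ n ] = - fromℕ (suc n)

  negate-homo : ∀ i → fromℤ (ℤ.- i) ≈ - fromℤ i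
  negate-homo -[1+ n ]  = sym (⁻¹-involutive _)
  negate-homo (+ zero)  = sym ε⁻¹≈ε
  negate-homo (+ suc n) = refl

  cancelˡ : ∀ x y z → (x + y) - (x + z) ≈ y - z
  cancelˡ x y z = begin
    (x + y) - (x + z)      ≈⟨ +-congˡ (⁻¹-∙-comm x z) ⟨
    (x + y) + (- x - z)    ≈⟨ +-congʳ (+-comm x y) ⟩
    (y + x) + (- x - z)    ≈⟨ +-assoc _ _ _ ⟩
    y + (x + (- x - z))    ≈⟨ +-congˡ (+-assoc _ _ _) ⟨
    y + ((x - x) - z)      ≈⟨ +-congˡ (+-congʳ (-‿inverseʳ x)) ⟩
    y + (0# - z)           ≈⟨ +-congˡ (+-identityˡ _) ⟩
    y - z                  ∎

  ⊖-homo : ∀ m n → fromℤ (m ⊖ n) ≈ fromℕ m - fromℕ n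
  ⊖-homo m zero = begin
    fromℕ m         ≈⟨ +-identityʳ _ ⟨
    fromℕ m + 0#    ≈⟨ +-congˡ ε⁻¹≈ε ⟨
    fromℕ m - 0#    ∎
  ⊖-homo zero    (suc n) = sym (+-identityˡ _)
  ⊖-homo (suc m) (suc n) = begin
    fromℤ (suc m ⊖ suc n)              ≡⟨ ≡.cong fromℤ (ℤ.[1+m]⊖[1+n]≡m⊖n m n) ⟩
    fromℤ (m ⊖ n)                      ≈⟨ ⊖-homo m n ⟩
    fromℕ m - fromℕ n                  ≈⟨ cancelˡ 1# _ _ ⟨
    (1# + fromℕ m) - (1# + fromℕ n)    ≈⟨ +-cong (1+× m 1#) (-‿cong (1+× n 1#)) ⟨
    fromℕ (suc m) - fromℕ (suc n)      ∎

  +-homo : ∀ i j → fromℤ (i ℤ.+ j) ≈ fromℤ i + fromℤ j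
  +-homo -[1+ m ] -[1+ n ] = begin
    - fromℕ (suc (suc (m ℕ.+ n)))        ≡⟨ ≡.cong (λ k → - fromℕ (suc k)) (ℕ.+-suc m n) ⟨
    - fromℕ (suc m ℕ.+ suc n)            ≈⟨ -‿cong (×-homo-+ 1# (suc m) (suc n)) ⟩
    - (fromℕ (suc m) + fromℕ (suc n))    ≈⟨ ⁻¹-∙-comm _ _ ⟨
    - fromℕ (suc m) - fromℕ (suc n)      ∎
  +-homo -[1+ m ] (+ n)    = trans (⊖-homo n (suc m)) (+-comm _ _)
  +-homo (+ m)    -[1+ n ] = ⊖-homo m (suc n)
  +-homo (+ m)    (+ n)    = ×-homo-+ 1# m n

  +◃-homo : ∀ n → fromℤ (Sign.+ ◃ n) ≈ fromℕ n
  +◃-homo zero    = refl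
  +◃-homo (suc n) = refl

  -◃-homo : ∀ n → fromℤ (Sign.- ◃ n) ≈ - fromℕ n
  -◃-homo zero    = sym ε⁻¹≈ε
  -◃-homo (suc n) = refl

  *-homo : ∀ i j → fromℤ (i ℤ.* j) ≈ fromℤ i * fromℤ j
  *-homo (+ m) (+ n) = trans (+◃-homo (m ℕ.* n)) (×1-homo-* m n)
  *-homo (+ m) -[1+ n ] = begin
    fromℤ (Sign.- ◃ (m ℕ.* suc n))    ≈⟨ -◃-homo (m ℕ.* suc n) ⟩
    - fromℕ (m ℕ.* suc n)             ≈⟨ -‿cong (×1-homo-* m (suc n)) ⟩
    - (fromℕ m * fromℕ (suc n))       ≈⟨ -‿distribʳ-* _ _ ⟩
    fromℕ m * - fromℕ (suc n)         ∎
  *-homo -[1+ m ] (+ n) = begin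
    fromℤ (Sign.- ◃ (suc m ℕ.* n))    ≈⟨ -◃-homo (suc m ℕ.* n) ⟩
    - fromℕ (suc m ℕ.* n)             ≈⟨ -‿cong (×1-homo-* (suc m) n) ⟩
    - (fromℕ (suc m) * fromℕ n)       ≈⟨ -‿distribˡ-* _ _ ⟩
    - fromℕ (suc m) * fromℕ n         ∎
  *-homo -[1+ m ] -[1+ n ] = begin
    fromℕ (suc m ℕ.* suc n)                ≈⟨ ×1-homo-* (suc m) (suc n) ⟩
    fromℕ (suc m) * fromℕ (suc n)          ≈⟨ ⁻¹-involutive _ ⟨
    - (- (fromℕ (suc m) * fromℕ (suc n)))  ≈⟨ -‿cong (-‿distribˡ-* _ _) ⟩
    - (- fromℕ (suc m) * fromℕ (suc n))    ≈⟨ -‿distribʳ-* _ _ ⟩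
    - fromℕ (suc m) * - fromℕ (suc n)      ∎

  ℤ-rawRing : RawRing 0ℓ 0ℓ
  ℤ-rawRing = ℤ.+-*-rawRing

  morphism : ℤ-rawRing -Raw-AlmostCommutative⟶ fromCommutativeRing R
  morphism = record
    { ⟦_⟧    = fromℤ
    ; +-homo = +-homo
    ; *-homo = *-homo
    ; -‿homo = negate-homo
    ; 0-homo = refl
    ; 1-homo = refl
    }

  equalCoefficients : ∀ i j → Maybe (fromℤ i ≈ fromℤ j)
  equalCoefficients i j =
    map (λ i≡j → reflexive (≡.cong fromℤ i≡j)) (dec⇒maybe (i ℤ.≟ j))

  open import Algebra.Solver.Ring ℤ-rawRing (fromCommutativeRing R)
    morphism equalCoefficients public
    using (Polynomial; con; solve; _:=_; _:+_; _:*_; :-_; _:-_)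

  :1 : ∀ {n} → Polynomial n
  :1 = con (+ 1)

  :0 : ∀ {n} → Polynomial n
  :0 = con (+ 0)

-- Order arithmetic and consequences of completeness.

module Order (em : ExcludedMiddle 0ℓ) (R : CompleteOrderedField) where

  open CompleteOrderedField R
  open IntegerSolver commutativeRing
  open IsTotalOrder isTotalOrder public using (total; antisym)
    renaming (refl to ≤-refl; trans to ≤-trans; reflexive to ≤-reflexive)

  ≤-resp₂ : ∀ {x x′ y y′} → x ≈ x′ → y ≈ y′ → x ≤ y → x′ ≤ y′
  ≤-resp₂ x≈x′ y≈y′ x≤y =
    ≤-trans (≤-reflexive (sym x≈x′)) (≤-trans x≤y (≤-reflexive y≈y′))

  <⇒≤ : ∀ {x y} → x < y → x ≤ y
  <⇒≤ = proj₁

  <⇒≱ : ∀ {x y} → x < y → ¬ y ≤ x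
  <⇒≱ (x≤y , x≉y) y≤x = x≉y (antisym x≤y y≤x)

  ≰⇒> : ∀ {x y} → ¬ x ≤ y → y < x
  ≰⇒> {x} {y} x≰y with total x y
  ... | inj₁ x≤y = ⊥-elim (x≰y x≤y)
  ... | inj₂ y≤x = y≤x , λ y≈x → x≰y (≤-reflexive (sym y≈x))

  ≤-or-> : ∀ x y → x ≤ y ⊎ y < x
  ≤-or-> x y with em {x ≤ y}
  ... | yes x≤y = inj₁ x≤y
  ... | no  x≰y = inj₂ (≰⇒> x≰y)

  ≤-<-trans : ∀ {x y z} → x ≤ y → y < z → x < z
  ≤-<-trans x≤y y<z = ≰⇒> λ z≤x → <⇒≱ y<z (≤-trans z≤x x≤y)

  <-≤-trans : ∀ {x y z} → x < y → y ≤ z → x < z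
  <-≤-trans x<y y≤z = ≰⇒> λ z≤x → <⇒≱ x<y (≤-trans y≤z z≤x)

  <-resp₂ : ∀ {x x′ y y′} → x ≈ x′ → y ≈ y′ → x < y → x′ < y′
  <-resp₂ x≈x′ y≈y′ (x≤y , x≉y) =
    ≤-resp₂ x≈x′ y≈y′ x≤y , λ x′≈y′ → x≉y (trans x≈x′ (trans x′≈y′ (sym y≈y′)))

  x≤y⇒0≤y-x : ∀ {x y} → x ≤ y → 0# ≤ y - x
  x≤y⇒0≤y-x {x} {y} x≤y =
    ≤-resp₂ (-‿inverseˡ x) (+-comm _ _) (+-monoʳ-≤ (- x) x≤y)

  -- The standard way to prove inequalities below: present a visibly nonnegative `d` and let the
  -- ring solver identify it with the difference.
  ≤-by : ∀ {d} x y → 0# ≤ d → d ≈ y - x → x ≤ y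
  ≤-by x y 0≤d d≈y-x = ≤-resp₂ (+-identityʳ x)
    (trans (+-congˡ d≈y-x) (solve 2 (λ x y → x :+ (y :- x) := y) refl x y))
    (+-monoʳ-≤ x 0≤d)

  x<y⇒0<y-x : ∀ {x y} → x < y → 0# < y - x
  x<y⇒0<y-x {x} {y} x<y = ≰⇒> λ y-x≤0 → <⇒≱ x<y
    (≤-by y x (x≤y⇒0≤y-x y-x≤0)
      (solve 2 (λ x y → :0 :- (y :- x) := x :- y) refl x y))

  <-by : ∀ {d} x y → 0# < d → d ≈ y - x → x < y
  <-by x y 0<d d≈y-x = ≰⇒> λ y≤x → <⇒≱ 0<d
    (≤-by _ _ (x≤y⇒0≤y-x y≤x) (trans (lemma x y) (+-congˡ (-‿cong (sym d≈y-x)))))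
    where
    lemma : ∀ x y → x - y ≈ 0# - (y - x)
    lemma = solve 2 (λ x y → x :- y := :0 :- (y :- x)) refl

  +-nonneg : ∀ {x y} → 0# ≤ x → 0# ≤ y → 0# ≤ x + y
  +-nonneg {x} 0≤x 0≤y =
    ≤-trans 0≤x (≤-resp₂ (+-identityʳ x) refl (+-monoʳ-≤ x 0≤y))

  +-pos-nonneg : ∀ {x y} → 0# < x → 0# ≤ y → 0# < x + y
  +-pos-nonneg {x} 0<x 0≤y =
    <-≤-trans 0<x (≤-resp₂ (+-identityʳ x) refl (+-monoʳ-≤ x 0≤y))

  *-zero-cancel : ∀ {x y} → ¬ x ≈ 0# → x * y ≈ 0# → y ≈ 0#
  *-zero-cancel {x} {y} x≉0 xy≈0 = begin
    y                ≈⟨ *-identityˡ y ⟨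
    1# * y           ≈⟨ *-congʳ (⁻¹-inverseʳ x x≉0) ⟨
    x * x ⁻¹ * y     ≈⟨ solve 3 (λ x x⁻¹ y → x :* x⁻¹ :* y := x⁻¹ :* (x :* y)) refl x (x ⁻¹) y ⟩
    x ⁻¹ * (x * y)   ≈⟨ *-congˡ xy≈0 ⟩
    x ⁻¹ * 0#        ≈⟨ zeroʳ _ ⟩
    0#               ∎
    where open import Relation.Binary.Reasoning.Setoid setoid

  0<⇒≉0 : ∀ {x} → 0# < x → ¬ x ≈ 0#
  0<⇒≉0 (_ , 0≉x) x≈0 = 0≉x (sym x≈0)

  *-pos : ∀ {x y} → 0# < x → 0# < y → 0# < x * y
  *-pos 0<x 0<y = *-nonneg (<⇒≤ 0<x) (<⇒≤ 0<y) ,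
    λ 0≈xy → 0<⇒≉0 0<y (*-zero-cancel (0<⇒≉0 0<x) (sym 0≈xy))

  *-cancelˡ-≤ : ∀ {a x y} → 0# < a → a * x ≤ a * y → x ≤ y
  *-cancelˡ-≤ {a} {x} {y} 0<a ax≤ay with ≤-or-> x y
  ... | inj₁ x≤y = x≤y
  ... | inj₂ y<x = ⊥-elim (<⇒≱ (<-by (a * y) (a * x) (*-pos 0<a (x<y⇒0<y-x y<x))
    (solve 3 (λ a x y → a :* (x :- y) := a :* x :- a :* y) refl a x y)) ax≤ay)

  0<1 : 0# < 1#
  0<1 with total 0# 1#
  ... | inj₁ 0≤1 = 0≤1 , 0≉1
  -- Here -1 would be nonnegative, and then so would its square, which is 1.
  ... | inj₂ 1≤0 = ≤-by 0# 1# (*-nonneg 0≤-1 0≤-1)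
    (solve 0 ((:0 :- :1) :* (:0 :- :1) := :1 :- :0) refl) , 0≉1
    where
    0≤-1 : 0# ≤ 0# - 1#
    0≤-1 = x≤y⇒0≤y-x 1≤0

  -- Otherwise s - w would be an upper bound below the supremum s.
  ¬-shift-closed : ∀ {w} (P : Pred Carrier 0ℓ) → 0# < w →
                   Satisfiable P → Satisfiable (UpperBound P) →
                   ¬ (∀ e → P e → P (e + w))
  ¬-shift-closed {w} P 0<w nonempty bounded shift
    with s , s-upper , s-least ← complete P nonempty bounded =
    <⇒≱ (<-by (s - w) s 0<w (solve 2 (λ s w → w := s :- (s :- w)) refl s w))
      (s-least (s - w) λ e e∈P → ≤-by e (s - w)
        (x≤y⇒0≤y-x (s-upper (e + w) (shift e e∈P)))
        (solve 3 (λ s e w → s :- (e :+ w) := s :- w :- e) refl s e w))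

  -- If `e` is a lower bound of all `len n`, then so is `e` divided by `β`. When `e` is at least a
  -- positive `d`, this exceeds `e` by at least `(1# - β) * d`, so the lower bounds above `d` would
  -- be closed under a fixed shift although `len 0` bounds them.
  geometric-vanishes : ∀ {β d} (len : ℕ → Carrier) → 0# < β → β < 1# →
                       (∀ n → len (suc n) ≈ β * len n) →
                       (∀ n → d ≤ len n) → d ≤ 0#
  geometric-vanishes {β} {d} len 0<β β<1 len-suc d≤len with ≤-or-> d 0#
  ... | inj₁ d≤0 = d≤0
  ... | inj₂ 0<d = ⊥-elim (¬-shift-closed P
          (*-pos 0<1-β 0<d)
          (d , ≤-refl , d≤len)
          (len 0 , λ _ e∈P → proj₂ e∈P 0)
          shift)
    where
    P : Pred Carrier 0ℓ
    P e = d ≤ e × (∀ n → e ≤ len n)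

    0<1-β : 0# < 1# - β
    0<1-β = x<y⇒0<y-x β<1

    shift : ∀ e → P e → P (e + (1# - β) * d)
    shift e (d≤e , e≤len) =
      ≤-by d _ (+-nonneg (x≤y⇒0≤y-x d≤e) (<⇒≤ (*-pos 0<1-β 0<d)))
        (solve 3 (λ e d b → (e :- d) :+ (:1 :- b) :* d := e :+ (:1 :- b) :* d :- d) refl e d β) ,
      λ n → *-cancelˡ-≤ 0<β (≤-trans
        (≤-by (β * (e + (1# - β) * d)) e
          (*-nonneg (<⇒≤ 0<1-β)
            (+-nonneg (x≤y⇒0≤y-x d≤e) (<⇒≤ (*-pos 0<1-β 0<d))))
          (solve 3 (λ e d b → (:1 :- b) :* ((e :- d) :+ (:1 :- b) :* d) :=
             e :- b :* (e :+ (:1 :- b) :* d)) refl e d β))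
        (≤-resp₂ refl (len-suc n) (e≤len (suc n))))

  -- Q models the positions, relative to Bob's current interval, at which a
  -- point is caught by every later interval; one round magnifies by 1/β and
  -- lets Bob shift by up to w.
  module Magnification {β w : Carrier}
                       (0<β : 0# < β) (0<1-3β : 0# < 1# - (1# + 1# + 1#) * β)
                       (0<w : 0# < w) where

    -- The point is near the left end: an interval at offset 0 must catch it, and Bob may use any
    -- offset `τ` up to `w`, after which the point has relative position `(p - τ) / β`. The equation
    -- for `q` expresses this quotient without division.
    Near : Pred Carrier 0ℓ → Pred Carrier 0ℓ
    Near Q p = p ≤ β × (∀ τ q → 0# ≤ τ → τ ≤ w → β * q ≈ p - τ → Q q)

    mirror : Pred Carrier 0ℓ → Pred Carrier 0ℓ
    mirror Q p = Q (1# - p)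

    Filled : Pred Carrier 0ℓ → Carrier → Carrier → Set
    Filled Q c e = ∀ p → c ≤ p → p ≤ c + e → Q p

    0≤β : 0# ≤ β
    0≤β = <⇒≤ 0<β

    0≤1-3β : 0# ≤ 1# - (1# + 1# + 1#) * β
    0≤1-3β = <⇒≤ 0<1-3β

    0≤1-β : 0# ≤ 1# - β
    0≤1-β = ≤-resp₂ refl
      (solve 1 (λ b → :1 :- (:1 :+ :1 :+ :1) :* b :+ b :+ b := :1 :- b) refl β)
      (+-nonneg (+-nonneg 0≤1-3β 0≤β) 0≤β)

    β<1-2β : β < 1# - β - β
    β<1-2β = <-by β (1# - β - β) 0<1-3β
      (solve 1 (λ b → :1 :- (:1 :+ :1 :+ :1) :* b := :1 :- b :- b :- b) refl β)

    β<1-β : β < 1# - β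
    β<1-β = <-≤-trans β<1-2β (≤-by (1# - β - β) (1# - β) 0≤β
      (solve 1 (λ b → b := :1 :- b :- (:1 :- b :- b)) refl β))

    1-involutive : ∀ p → 1# - (1# - p) ≈ p
    1-involutive = solve 1 (λ p → :1 :- (:1 :- p) := p) refl

    1-antimono : ∀ {p q} → p ≤ q → 1# - q ≤ 1# - p
    1-antimono {p} {q} p≤q = ≤-by (1# - q) (1# - p) (x≤y⇒0≤y-x p≤q)
      (solve 2 (λ p q → q :- p := :1 :- p :- (:1 :- q)) refl p q)

    Near-resp : ∀ {Q p p′} → p ≈ p′ → Near Q p → Near Q p′
    Near-resp p≈p′ (p≤β , next) = ≤-resp₂ p≈p′ refl p≤β ,
      λ τ q 0≤τ τ≤w eq → next τ q 0≤τ τ≤w (trans eq (+-congʳ (sym p≈p′)))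

    -- The position `q` is obtained from every `p` of the form `β * q + τ`. Hence all `q` with
    -- `β * q` between `c - w` and `c + e` are covered, a segment of length `(e + w) / β`, of which
    -- the first `e + w` is kept.
    stretch : ∀ {Q c e} → 0# ≤ e → (∀ p → c ≤ p → p ≤ c + e → Near Q p) →
              ∃ λ c′ → Filled Q c′ (e + w)
    stretch {Q} {c} {e} 0≤e near = c′ , filled
      where
      open import Relation.Binary.Reasoning.Setoid setoid
      c′ : Carrier
      c′ = β ⁻¹ * (c - w)

      βc′ : β * c′ ≈ c - w
      βc′ = begin
        β * (β ⁻¹ * (c - w))    ≈⟨ *-assoc _ _ _ ⟨
        β * β ⁻¹ * (c - w)      ≈⟨ *-congʳ (⁻¹-inverseʳ β (0<⇒≉0 0<β)) ⟩
        1# * (c - w)            ≈⟨ *-identityˡ _ ⟩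
        c - w                   ∎

      filled : Filled Q c′ (e + w)
      filled q c′≤q q≤ with total (β * q) c
      -- Left of the given segment, shift from its endpoint `c`; otherwise `β * q` lies in the
      -- segment and no shift is made.
      ... | inj₁ βq≤c = proj₂ (near c ≤-refl
              (≤-by c (c + e) 0≤e (solve 2 (λ c e → e := c :+ e :- c) refl c e)))
              (c - β * q) q (x≤y⇒0≤y-x βq≤c)
              (≤-by (c - β * q) w (*-nonneg 0≤β (x≤y⇒0≤y-x c′≤q)) (begin
                β * (q - c′)          ≈⟨ solve 3 (λ b q c′ → b :* (q :- c′) := b :* q :- b :* c′)
                    refl β q c′ ⟩
                β * q - β * c′        ≈⟨ +-congˡ (-‿cong βc′) ⟩
                β * q - (c - w)       ≈⟨ solve 4 (λ b q c w → b :* q :- (c :- w) := w :- (c :- b :* q))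
                    refl β q c w ⟩
                w - (c - β * q)       ∎))
              (solve 3 (λ b q c → b :* q := c :- (c :- b :* q)) refl β q c)
      ... | inj₂ c≤βq = proj₂ (near (β * q) c≤βq
              (≤-by (β * q) (c + e)
                (+-nonneg (*-nonneg 0≤1-β (+-nonneg 0≤e (<⇒≤ 0<w)))
                          (*-nonneg 0≤β (x≤y⇒0≤y-x q≤)))
                (begin
                  (1# - β) * (e + w) + β * (c′ + (e + w) - q)
                    ≈⟨ solve 5 (λ b e w c′ q → (:1 :- b) :* (e :+ w) :+ b :* (c′ :+ (e :+ w) :- q)
                         := b :* c′ :+ (e :+ w) :- b :* q) refl β e w c′ q ⟩
                  β * c′ + (e + w) - β * q
                    ≈⟨ +-congʳ (+-congʳ βc′) ⟩
                  c - w + (e + w) - β * q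
                    ≈⟨ solve 5 (λ b q c e w → c :- w :+ (e :+ w) :- b :* q := c :+ e :- b :* q)
                        refl β q c e w ⟩
                  c + e - β * q ∎)))
              0# q ≤-refl (<⇒≤ 0<w)
              (solve 2 (λ b q → b :* q := b :* q :- :0) refl β q)

    module _ (Q : Pred Carrier 0ℓ)
             (Q-resp : ∀ {p p′} → p ≈ p′ → Q p → Q p′)
             (Q-bounds : ∀ p → Q p → 0# ≤ p × p ≤ 1#)
             (Q-split : ∀ p → Q p → Near Q p ⊎ Near (mirror Q) (1# - p)) where

      -- A segment inside `Q` lies entirely near one end, so `stretch` applies to it or to its
      -- mirror image.
      grow : ∀ {c e} → 0# ≤ e → Filled Q c e → ∃ λ c′ → Filled Q c′ (e + w)
      grow {c} {e} 0≤e filled with Q-split c (filled c ≤-refl c≤c+e)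
        where
        c≤c+e = ≤-by c (c + e) 0≤e (solve 2 (λ c e → e := c :+ e :- c) refl c e)
      ... | inj₁ (c≤β , _) = stretch 0≤e near
        where
        -- A segment with points near both ends would contain this position, which is at distance
        -- more than `β` from either end because `3β < 1`.
        middle : Carrier
        middle = 1# - β - β

        near : ∀ p → c ≤ p → p ≤ c + e → Near Q p
        near p c≤p p≤ with Q-split p (filled p c≤p p≤)
        ... | inj₁ near-p = near-p
        ... | inj₂ (1-p≤β , _) = ⊥-elim ([ (λ (m≤β , _) → <⇒≱ β<1-2β m≤β) ,
                                           (λ (1-m≤β , _) → <⇒≱ β<1-middle 1-m≤β) ]′
                (Q-split middle (filled middle (≤-trans c≤β (<⇒≤ β<1-2β)) (≤-trans middle≤p p≤))))
          where
          middle≤p : middle ≤ p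
          middle≤p = ≤-by middle p (+-nonneg (x≤y⇒0≤y-x 1-p≤β) 0≤β)
            (solve 2 (λ b p → b :- (:1 :- p) :+ b := p :- (:1 :- b :- b)) refl β p)

          β<1-middle : β < 1# - middle
          β<1-middle = <-by β (1# - middle) 0<β
            (solve 1 (λ b → b := :1 :- (:1 :- b :- b) :- b) refl β)
      -- The left endpoint `c` is already near the right end, hence so is the rest. The mirrored
      -- segment is stretched and reflected back, which exchanges its endpoints.
      ... | inj₂ (1-c≤β , _) = 1# - (c″ + (e + w)) , λ p lower upper →
              Q-resp (1-involutive p) (filled″ (1# - p)
                (≤-by c″ (1# - p) (x≤y⇒0≤y-x upper)
                  (solve 3 (λ d p f → :1 :- (d :+ f) :+ f :- p := :1 :- p :- d) refl c″ p (e + w)))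
                (≤-resp₂ refl (1-involutive _) (1-antimono lower)))
        where
        near : ∀ p → 1# - (c + e) ≤ p → p ≤ 1# - (c + e) + e → Near (mirror Q) p
        near p lower upper with Q-split (1# - p) (filled (1# - p)
               (≤-by c (1# - p) (x≤y⇒0≤y-x upper)
                 (solve 3 (λ c p e → :1 :- (c :+ e) :+ e :- p := :1 :- p :- c) refl c p e))
               (≤-resp₂ refl (1-involutive _) (1-antimono lower)))
        ... | inj₁ (1-p≤β , _) = ⊥-elim (<⇒≱ β<1-β (≤-by (1# - β) β
                (+-nonneg (+-nonneg (x≤y⇒0≤y-x 1-p≤β) (x≤y⇒0≤y-x upper)) (x≤y⇒0≤y-x 1-c≤β))
                (solve 4 (λ b p c e → b :- (:1 :- p) :+ (:1 :- (c :+ e) :+ e :- p) :+ (b :- (:1 :- c))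
                  := b :- (:1 :- b)) refl β p c e)))
        ... | inj₂ near-p = Near-resp {mirror Q} (1-involutive p) near-p

        stretched = stretch {mirror Q} 0≤e near
        c″ = proj₁ stretched
        filled″ = proj₂ stretched

      -- The lengths of segments inside `Q` are bounded by 1, yet closed under adding `w` by `grow`.
      -- A single point of `Q` supplies the length 0 to start from.
      Q-empty : ¬ Satisfiable Q
      Q-empty (p , p∈Q) = ¬-shift-closed P 0<w
        (0# , ≤-refl , p , λ q p≤q q≤ → Q-resp (antisym p≤q (≤-resp₂ refl (+-identityʳ p) q≤)) p∈Q)
        (1# , λ e (0≤e , c , filled) →
          let c≤c+e = ≤-by c (c + e) 0≤e (solve 2 (λ c e → e := c :+ e :- c) refl c e)
              0≤c   = proj₁ (Q-bounds c (filled c ≤-refl c≤c+e))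
              c+e≤1 = proj₂ (Q-bounds (c + e) (filled (c + e) c≤c+e ≤-refl))
          in ≤-by e 1# (+-nonneg 0≤c (x≤y⇒0≤y-x c+e≤1))
               (solve 2 (λ c e → c :+ (:1 :- (c :+ e)) := :1 :- e) refl c e))
        λ e (0≤e , c , filled) → +-nonneg 0≤e (<⇒≤ 0<w) , grow 0≤e filled
        where
        P : Pred Carrier 0ℓ
        P e = 0# ≤ e × (∃ λ c → Filled Q c e)

-- Compact intervals and closed sets.

module Intervals (em : ExcludedMiddle 0ℓ) (R : CompleteOrderedField) where

  open CompleteOrderedField R
  open IntegerSolver commutativeRing
  open RealLine R
  open Order em R

  lo∈ : ∀ I → ⟦ I ⟧ᶜ (lo I)
  lo∈ I = ≤-refl , <⇒≤ (lo<hi I)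

  ∈-resp : ∀ I {x y} → x ≈ y → ⟦ I ⟧ᶜ x → ⟦ I ⟧ᶜ y
  ∈-resp I x≈y (lo≤x , x≤hi) = ≤-resp₂ refl x≈y lo≤x , ≤-resp₂ x≈y refl x≤hi

  DisjointFrom : Pred Carrier 0ℓ → Pred Carrier 0ℓ → Set
  DisjointFrom P Q = ∀ x → P x → ¬ Q x

  -- The supremum of the left endpoints is a common point, since no left endpoint exceeds any right
  -- endpoint.
  nested-intersection : (I : ℕ → CompactInterval) →
                        (∀ n → ⟦ I (suc n) ⟧ᶜ ⊆ ⟦ I n ⟧ᶜ) →
                        ∃ λ x → ∀ n → ⟦ I n ⟧ᶜ x
  nested-intersection I shrinks =
    let s , s-upper , s-least = complete LeftEnd (lo (I 0) , 0 , refl) (hi (I 0) , lo≤hi 0)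
    in  s , λ n → s-upper (lo (I n)) (n , refl) , s-least (hi (I n)) (lo≤hi n)
    where
    LeftEnd : Pred Carrier 0ℓ
    LeftEnd x = ∃ λ n → x ≈ lo (I n)

    shrinks-by : ∀ k n → ⟦ I (k ℕ.+ n) ⟧ᶜ ⊆ ⟦ I n ⟧ᶜ
    shrinks-by zero    n x∈ = x∈
    shrinks-by (suc k) n x∈ = shrinks-by k n (shrinks (k ℕ.+ n) x∈)

    lo≤hi : ∀ n → UpperBound LeftEnd (hi (I n))
    -- The interval with index `n + m` lies in both of the intervals compared, so its left endpoint
    -- separates them.
    lo≤hi n x (m , x≈lo) = ≤-resp₂ (sym x≈lo) refl (≤-trans
      (proj₁ (shrinks-by n m (lo∈ (I (n ℕ.+ m)))))
      (proj₂ (shrinks-by m n (≡.subst (λ k → ⟦ I k ⟧ᶜ (lo (I (n ℕ.+ m))))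
        (ℕ.+-comm n m) (lo∈ (I (n ℕ.+ m)))))))

  -- Not an isolated point of `P`, but a point with a neighbourhood that misses `P`: the conclusion
  -- of `Closed` for a bare predicate.
  Isolated : Pred Carrier 0ℓ → Pred Carrier 0ℓ
  Isolated P x = ∃ λ ε → 0# < ε × (∀ y → x - ε < y → y < x + ε → ¬ P y)

  interval-closed : ∀ I x → ¬ ⟦ I ⟧ᶜ x → Isolated ⟦ I ⟧ᶜ x
  interval-closed I x x∉I with ≤-or-> (lo I) x
  ... | inj₂ x<lo = lo I - x , x<y⇒0<y-x x<lo , λ y _ y< (lo≤y , _) →
        <⇒≱ (<-resp₂ refl (solve 2 (λ x l → x :+ (l :- x) := l) refl x (lo I)) y<) lo≤y
  ... | inj₁ lo≤x with ≤-or-> x (hi I)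
  ... | inj₁ x≤hi = ⊥-elim (x∉I (lo≤x , x≤hi))
  ... | inj₂ hi<x = x - hi I , x<y⇒0<y-x hi<x , λ y <y _ (_ , y≤hi) →
        <⇒≱ (<-resp₂ (solve 2 (λ x h → x :- (x :- h) := h) refl x (hi I)) refl <y) y≤hi

  isolated-⊎ : ∀ {P Q x} → Isolated P x → Isolated Q x → Isolated (λ y → P y ⊎ Q y) x
  isolated-⊎ {P} {Q} {x} (ε , 0<ε , ε-avoids) (δ , 0<δ , δ-avoids) with total ε δ
  ... | inj₁ ε≤δ = ε , 0<ε , λ y <y y< →
        [ ε-avoids y <y y<
        , δ-avoids y
            (≤-<-trans (≤-by (x - δ) (x - ε) (x≤y⇒0≤y-x ε≤δ)
              (solve 3 (λ x ε δ → δ :- ε := x :- ε :- (x :- δ)) refl x ε δ)) <y)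
            (<-≤-trans y< (+-monoʳ-≤ x ε≤δ)) ]′
  ... | inj₂ δ≤ε = δ , 0<δ , λ y <y y< →
        [ ε-avoids y
            (≤-<-trans (≤-by (x - ε) (x - δ) (x≤y⇒0≤y-x δ≤ε)
              (solve 3 (λ x ε δ → ε :- δ := x :- δ :- (x :- ε)) refl x ε δ)) <y)
            (<-≤-trans y< (+-monoʳ-≤ x δ≤ε))
        , δ-avoids y <y y< ]′

  -- Cantor sets from trees of intervals.

  module CantorScheme
    {V : Set} (_⟶_ : Rel V 0ℓ) (I : V → CompactInterval)
    (shrinks : ∀ {v w} → v ⟶ w → ⟦ I w ⟧ᶜ ⊆ ⟦ I v ⟧ᶜ)
    (fork : ∀ v → ∃ λ (child : Bool → V) →
            (∀ b → TransClosure _⟶_ v (child b)) ×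
            DisjointFrom ⟦ I (child true) ⟧ᶜ ⟦ I (child false) ⟧ᶜ)
    where

    child : Bool → V → V
    child b v = proj₁ (fork v) b

    path : ∀ b v → TransClosure _⟶_ v (child b v)
    path b v = proj₁ (proj₂ (fork v)) b

    children-disjoint : ∀ v → DisjointFrom ⟦ I (child true v) ⟧ᶜ ⟦ I (child false v) ⟧ᶜ
    children-disjoint v = proj₂ (proj₂ (fork v))

    shrinks⁺ : ∀ {v w} → TransClosure _⟶_ v w → ⟦ I w ⟧ᶜ ⊆ ⟦ I v ⟧ᶜ
    shrinks⁺ [ e ]   x∈ = shrinks e x∈
    shrinks⁺ (e ∷ p) x∈ = shrinks e (shrinks⁺ p x∈)

    Level : ℕ → V → Pred Carrier 0ℓ
    Level zero    v x = ⟦ I v ⟧ᶜ x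
    Level (suc n) v x = Level n (child true v) x ⊎ Level n (child false v) x

    Level⊆I : ∀ n v → Level n v ⊆ ⟦ I v ⟧ᶜ
    Level⊆I zero    v x∈        = x∈
    Level⊆I (suc n) v (inj₁ x∈) = shrinks⁺ (path true v) (Level⊆I n _ x∈)
    Level⊆I (suc n) v (inj₂ x∈) = shrinks⁺ (path false v) (Level⊆I n _ x∈)

    Level-child : ∀ n b v → Level n (child b v) ⊆ Level (suc n) v
    Level-child n true  v = inj₁
    Level-child n false v = inj₂

    Level-resp : ∀ n v {x y} → x ≈ y → Level n v x → Level n v y
    Level-resp zero    v x≈y x∈        = ∈-resp (I v) x≈y x∈
    Level-resp (suc n) v x≈y (inj₁ x∈) = inj₁ (Level-resp n _ x≈y x∈)
    Level-resp (suc n) v x≈y (inj₂ x∈) = inj₂ (Level-resp n _ x≈y x∈)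

    Level-closed : ∀ n v x → ¬ Level n v x → Isolated (Level n v) x
    Level-closed zero    v x x∉ = interval-closed (I v) x x∉
    Level-closed (suc n) v x x∉ = isolated-⊎
      (Level-closed n _ x λ x∈ → x∉ (inj₁ x∈))
      (Level-closed n _ x λ x∈ → x∉ (inj₂ x∈))

    -- Intersecting the finite unions `Level n v`, rather than collecting the limits of branches,
    -- makes closedness immediate from that of each level.
    cantorSet : V → Subset
    cantorSet v = record
      { member   = λ x → ∀ n → Level n v x
      ; respects = λ x≈y x∈ n → Level-resp n v x≈y (x∈ n)
      }

    cantorSet-closed : ∀ v → Closed (cantorSet v)
    cantorSet-closed v x x∉ with em {∃ λ n → ¬ Level n v x}
    ... | no  ∄n       = ⊥-elim (x∉ λ n → stable n em)
      where
      stable : ∀ n → Dec (Level n v x) → Level n v x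
      stable n (yes x∈) = x∈
      stable n (no  x∉) = ⊥-elim (∄n (n , x∉))
    ... | yes (n , x∉n) = let ε , 0<ε , avoids = Level-closed n v x x∉n
                          in  ε , 0<ε , λ y <y y< y∈ → avoids y <y y< (y∈ n)

    -- Level 1 selects the child; disjointness rules out the other child at every deeper level.
    branch : ∀ v {x} → member (cantorSet v) x → ∃ λ b → member (cantorSet (child b v)) x
    branch v {x} x∈ with x∈ 1
    ... | inj₁ x∈true = true , λ n → [ (λ x∈ → x∈) , (λ x∈false →
            ⊥-elim (children-disjoint v x x∈true (Level⊆I n _ x∈false))) ]′ (x∈ (suc n))
    ... | inj₂ x∈false = false , λ n → [ (λ x∈true →
            ⊥-elim (children-disjoint v x (Level⊆I n _ x∈true) x∈false)) , (λ x∈ → x∈) ]′ (x∈ (suc n))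

    -- Cantor's diagonal argument: the n-th fork is left through a child that avoids the point coded
    -- by `n`. The limit `y` is in the Cantor set but is avoided at the fork whose index is its own
    -- code.
    cantorSet-uncountable : ∀ v → Uncountable (cantorSet v)
    cantorSet-uncountable root countable = 
      proj₂ (escape (to y) (node (to y))) y ≡.refl (y∈I (suc (to y)))
      where
      open Injection countable

      Point : Set
      Point = Σ Carrier (member (cantorSet root))

      escape : ∀ n v → ∃ λ b → ∀ (z : Point) → to z ≡ n → ¬ ⟦ I (child b v) ⟧ᶜ (proj₁ z)
      escape n v with em {∃ λ (z : Point) → to z ≡ n × ⟦ I (child true v) ⟧ᶜ (proj₁ z)}
      ... | no  ∄z = true , λ z z↦n z∈ → ∄z (z , z↦n , z∈)
      -- By injectivity all points with code `n` agree up to `≈`, so the disjoint child avoids them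
      -- all.
      ... | yes (z , z↦n , z∈true) = false , λ z′ z′↦n z′∈false →
              children-disjoint v (proj₁ z) z∈true
                (∈-resp (I (child false v)) (injective {z′} {z} (≡.trans z′↦n (≡.sym z↦n))) z′∈false)

      node : ℕ → V
      node zero    = root
      node (suc n) = child (proj₁ (escape n (node n))) (node n)

      limit : ∃ λ x → ∀ n → ⟦ I (node n) ⟧ᶜ x
      limit = nested-intersection (λ n → I (node n)) λ n → shrinks⁺ (path _ (node n))

      y∈I : ∀ n → ⟦ I (node n) ⟧ᶜ (proj₁ limit)
      y∈I = proj₂ limit

      Level-root : ∀ n k → Level k (node n) ⊆ Level (n ℕ.+ k) root
      Level-root zero    k x∈ = x∈
      Level-root (suc n) k {x} x∈ = ≡.subst (λ m → Level m root x) (ℕ.+-suc n k)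
        (Level-root n (suc k) (Level-child k _ (node n) x∈))

      y : Point
      y = proj₁ limit , λ n → ≡.subst (λ m → Level m root (proj₁ limit)) (ℕ.+-identityʳ n)
            (Level-root n 0 (y∈I n))

    record InfinitePath (v : V) (x : Carrier) : Set where
      field
        vertex  : ℕ → V
        start   : vertex 0 ≡ v
        edge    : ∀ n → vertex n ⟶ vertex (suc n)
        outcome : ∀ n → ⟦ I (vertex n) ⟧ᶜ x

    -- A fork may lie several edges below its parent, whereas a play needs every single edge. The
    -- state therefore remembers the rest of the nonempty path to the next fork; on its last edge,
    -- `branch` chooses a new target that still contains `x`.
    cantorSet-path : ∀ v {x} → member (cantorSet v) x → InfinitePath v x
    cantorSet-path root {x} x∈root = record
      { vertex  = λ n → at (state n)
      ; start   = ≡.refl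
      ; edge    = λ n → edge (state n)
      ; outcome = λ n → outcome (state n)
      }
      where
      data State : Set where
        heading : ∀ {v w} → TransClosure _⟶_ v w → member (cantorSet w) x → State

      at : State → V
      at (heading {v} _ _) = v

      aim : ∀ v → member (cantorSet v) x → State
      aim v x∈ = let b , x∈child = branch v x∈ in heading (path b v) x∈child

      advance : State → State
      advance (heading {w = w} [ _ ] x∈) = aim w x∈
      advance (heading (_ ∷ p) x∈)       = heading p x∈

      edge : ∀ s → at s ⟶ at (advance s)
      edge (heading [ e ] _)   = e
      edge (heading (e ∷ _) _) = e

      outcome : ∀ s → ⟦ I (at s) ⟧ᶜ x
      outcome (heading p x∈) = shrinks⁺ p (x∈ 0)

      state : ℕ → State
      state zero    = aim root x∈root
      state (suc n) = advance (state n)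

-- Strategies in the absolute game.

module Game (em : ExcludedMiddle 0ℓ) (R : CompleteOrderedField) where

  open CompleteOrderedField R
  open IntegerSolver commutativeRing
  open RealLine R
  open Order em R
  open Intervals em R

  module Strategies (β : Carrier) (0<β : 0# < β) (β<⅓ : β < (1# + 1# + 1#) ⁻¹)
                    (S : Subset) where

    open AbsoluteGame R β S

    -- The relative room left in Bob's interval by three intervals of relative length `β`.
    γ : Carrier
    γ = 1# - (1# + 1# + 1#) * β

    0<γ : 0# < γ
    0<γ = <-resp₂ refl identity (*-pos 0<3 (x<y⇒0<y-x β<⅓))
      where
      3# : Carrier
      3# = 1# + 1# + 1#

      0<3 : 0# < 3#
      0<3 = +-pos-nonneg (+-pos-nonneg 0<1 (<⇒≤ 0<1)) (<⇒≤ 0<1)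

      identity : 3# * (3# ⁻¹ - β) ≈ γ
      identity = trans
        (solve 2 (λ t b → (:1 :+ :1 :+ :1) :* (t :- b)
            := (:1 :+ :1 :+ :1) :* t :- (:1 :+ :1 :+ :1) :* b)
            refl (3# ⁻¹) β)
        (+-congʳ (⁻¹-inverseʳ 3# (0<⇒≉0 0<3)))

    β<1 : β < 1#
    β<1 = <-by β 1# (+-pos-nonneg 0<γ (+-nonneg (<⇒≤ 0<β) (<⇒≤ 0<β)))
      (solve 1 (λ b → :1 :- (:1 :+ :1 :+ :1) :* b :+ (b :+ b) := :1 :- b) refl β)

    0≤1-β : 0# ≤ 1# - β
    0≤1-β = x≤y⇒0≤y-x (<⇒≤ β<1)

    0<length : ∀ I → 0# < length I
    0<length I = x<y⇒0<y-x (lo<hi I)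

    ≈ᶜ-refl : ∀ {B} → B ≈ᶜ B
    ≈ᶜ-refl = refl , refl

    ≈ⁱ-refl : ∀ {A} → A ≈ⁱ A
    ≈ⁱ-refl {A} = ≈ᶜ-refl {closure A} , ≡.refl , ≡.refl

    -- The difference `y - x` is at most every `length (B n)`, and these lengths decay
    -- geometrically. Exchanging `x` and `y` gives equality.
    intersection-unique : (p : Play) → let open Play p in
                          ∀ {x y} → (∀ n → ⟦ B n ⟧ᶜ x) → (∀ n → ⟦ B n ⟧ᶜ y) → y ≤ x
    intersection-unique p {x} {y} x∈ y∈ =
      ≤-by y x (x≤y⇒0≤y-x
        (geometric-vanishes (λ n → length (B n)) 0<β β<1 (λ n → proj₂ (bobLegal (suc n))) λ n →
          ≤-by (y - x) (length (B n))
            (+-nonneg (x≤y⇒0≤y-x (proj₁ (x∈ n))) (x≤y⇒0≤y-x (proj₂ (y∈ n))))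
            (solve 4 (λ x y l h → (x :- l) :+ (h :- y) := h :- l :- (y :- x))
                refl x y (lo (B n)) (hi (B n)))))
        (solve 2 (λ x y → :0 :- (y :- x) := x :- y) refl x y)
      where open Play p

    -- Vertices of the game trees carry their own histories; this identifies them with the histories
    -- that a `Play` computes from its moves.
    historyBefore-unique : ∀ B A (h : ℕ → History) → h 0 ≡ [] →
                           (∀ n → h (suc n) ≡ (B n , A n) ∷ h n) →
                           ∀ n → h n ≡ historyBefore B A n
    historyBefore-unique B A h h₀ hₛ zero    = h₀
    historyBefore-unique B A h h₀ hₛ (suc n) =
      ≡.trans (hₛ n) (≡.cong ((B n , A n) ∷_) (historyBefore-unique B A h h₀ hₛ n))

    closedInterval : CompactInterval → Interval
    closedInterval I = record { closure = I ; leftClosed = true ; rightClosed = true }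

    below⇒≤ : ∀ b {x y} → below b x y → x ≤ y
    below⇒≤ true  x≤y = x≤y
    below⇒≤ false x<y = <⇒≤ x<y

    -- Refuting a winning strategy of Bob.

    module AgainstBob (τ : BobStrategy) where

      open BobStrategy τ

      Vertex : Set
      Vertex = Σ History Legal

      I : Vertex → CompactInterval
      I (h , _) = move h

      _⟶_ : Rel Vertex 0ℓ
      (h , _) ⟶ (h′ , _) = ∃ λ A → AliceLegal (move h) A × h′ ≡ (move h , A) ∷ h

      shrinks : ∀ {v w} → v ⟶ w → ⟦ I w ⟧ᶜ ⊆ ⟦ I v ⟧ᶜ
      shrinks {w = h , Lh} (A , _ , ≡.refl) x∈ = proj₁ (proj₁ (legal h Lh) x∈)

      play : ((h , Lh) : Vertex) (A : Interval) → AliceLegal (move h) A → Vertex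
      play (h , Lh) A LA = (move h , A) ∷ h , Lh , legal h Lh , LA

      leftEnd : ∀ I → ∃ (AliceLegal I)
      leftEnd I = closedInterval J , (λ (lo≤x , x≤) → lo≤x , ≤-trans x≤ J≤hi) , lemma (lo I) _
        where
        lemma : ∀ a b → a + b - a ≈ b
        lemma = solve 2 (λ a b → a :+ b :- a := b) refl
        J : CompactInterval
        J = record { lo = lo I ; hi = lo I + β * length I
                   ; lo<hi = <-by _ _ (*-pos 0<β (0<length I)) (sym (lemma _ _)) }
        J≤hi : hi J ≤ hi I
        J≤hi = ≤-by (hi J) (hi I) (*-nonneg 0≤1-β (<⇒≤ (0<length I)))
          (solve 3 (λ b l h → (:1 :- b) :* (h :- l) := h :- (l :+ b :* (h :- l)))
              refl β (lo I) (hi I))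

      -- Bob's reply has exactly the length of Alice's moves, so Alice may occupy
      -- it, which forces Bob to a disjoint reply.
      fork : ∀ v → ∃ λ (child : Bool → Vertex) →
             (∀ b → TransClosure _⟶_ v (child b)) ×
             DisjointFrom ⟦ I (child true) ⟧ᶜ ⟦ I (child false) ⟧ᶜ
      fork v@(h , Lh) = child , path , λ x x∈B₁ x∈B₂ → proj₂ (proj₁ (legal _ (proj₂ v₂)) x∈B₂) x∈B₁
        where
        A₁  = proj₁ (leftEnd (move h))
        LA₁ = proj₂ (leftEnd (move h))
        v₁ = play v A₁ LA₁
        B₁ = I v₁
        LB₁ = legal _ (proj₂ v₁)
        A₂ = closedInterval B₁
        LA₂ : AliceLegal (move h) A₂
        LA₂ = (λ x∈ → proj₁ (proj₁ LB₁ x∈)) , proj₂ LB₁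
        v₂ = play v A₂ LA₂

        child : Bool → Vertex
        child true  = v₁
        child false = v₂

        path : ∀ b → TransClosure _⟶_ v (child b)
        path true  = [ A₁ , LA₁ , ≡.refl ]
        path false = [ A₂ , LA₂ , ≡.refl ]

      open CantorScheme _⟶_ I (λ {v} {w} → shrinks {v} {w}) fork

      root : Vertex
      root = [] , tt

      -- The Cantor set meets `S`, and a common point is the outcome of a play in which Bob follows
      -- `τ` and Alice wins.
      not-winning : Bernstein S → ¬ (∀ p → BobFollows τ p → BobWins p)
      not-winning bernstein wins =
        let x , x∈S , x∈C = Bernstein.meets bernstein (cantorSet root)
                              (cantorSet-closed root) (cantorSet-uncountable root)
            path = cantorSet-path root x∈C
        in  wins (playOf path) (λ n → follows path n)
              (x , (λ n → InfinitePath.outcome path n) , x∈S)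
        where
        module _ {x} (path : InfinitePath root x) where
          open InfinitePath path

          h : ℕ → History
          h n = proj₁ (vertex n)

          A : ℕ → Interval
          A n = proj₁ (edge n)

          history≡ : ∀ n → h n ≡ historyBefore (λ n → move (h n)) A n
          history≡ = historyBefore-unique _ A h (≡.cong proj₁ start) λ n → proj₂ (proj₂ (edge n))

          playOf : Play
          playOf = record
            { B          = λ n → move (h n)
            ; A          = A
            ; bobLegal   = λ n → ≡.subst (λ k → BobLegal k (move (h n))) (history≡ n)
                                   (legal (h n) (proj₂ (vertex n)))
            ; aliceLegal = λ n → proj₁ (proj₂ (edge n))
            }

          follows : BobFollows τ playOf
          follows n = ≡.subst (λ k → move (h n) ≈ᶜ move k) (history≡ n) (≈ᶜ-refl {move (h n)})

    -- Refuting a winning strategy of Alice.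

    module AgainstAlice (σ : AliceStrategy) where

      open AliceStrategy σ

      -- A position with Alice to move. An edge thus comprises her reply by `σ` and a legal next
      -- interval of Bob.
      Vertex : Set
      Vertex = Σ (History × CompactInterval) λ (h , B) → Legal h × BobLegal h B

      I : Vertex → CompactInterval
      I ((_ , B) , _) = B

      reply : Vertex → Interval
      reply ((h , B) , _) = move h B

      reply-legal : ∀ v → AliceLegal (I v) (reply v)
      reply-legal ((h , B) , Lh , LB) = legal h B Lh LB

      _⟶_ : Rel Vertex 0ℓ
      v@((h , B) , _) ⟶ ((h′ , _) , _) = h′ ≡ (B , reply v) ∷ h

      shrinks : ∀ {v w} → v ⟶ w → ⟦ I w ⟧ᶜ ⊆ ⟦ I v ⟧ᶜ
      shrinks {w = _ , _ , LB} ≡.refl x∈ = proj₁ (proj₁ LB x∈)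

      -- In the coordinate that turns `I v` into the unit interval, Bob's next interval runs from
      -- `s` to `s + β`.
      record Move (v : Vertex) (s : Carrier) : Set where
        field
          next   : Vertex
          edge   : v ⟶ next
          lo≈    : lo (I next) ≈ lo (I v) + s * length (I v)
          hi≈    : hi (I next) ≈ lo (I v) + (s + β) * length (I v)

        length≈ : length (I next) ≈ β * length (I v)
        length≈ = trans (+-cong hi≈ (-‿cong lo≈))
          (solve 4 (λ l s b L → l :+ (s :+ b) :* L :- (l :+ s :* L) := b :* L)
            refl (lo (I v)) s β (length (I v)))

      gap⁻ gap⁺ : Vertex → Carrier
      gap⁻ v = lo (closure (reply v))
      gap⁺ v = hi (closure (reply v))

      -- Strict separation from Alice's interval makes the move legal whichever of her endpoints
      -- belong to it.
      moveAt : ∀ v s → 0# ≤ s → s + β ≤ 1# →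
               lo (I v) + (s + β) * length (I v) < gap⁻ v ⊎ gap⁺ v < lo (I v) + s * length (I v) →
               Move v s
      moveAt v@((h , B) , Lh , LB) s 0≤s s+β≤1 clear = record
        { next = ((B , reply v) ∷ h , B′) , (Lh , LB , reply-legal v) , inside , lemma
        ; edge = ≡.refl
        ; lo≈  = refl
        ; hi≈  = refl
        }
        where
        L = length B

        lemma : lo B + (s + β) * L - (lo B + s * L) ≈ β * L
        lemma = solve 4 (λ l s b L → l :+ (s :+ b) :* L :- (l :+ s :* L) := b :* L)
          refl (lo B) s β L

        B′ : CompactInterval
        B′ = record { lo = lo B + s * L ; hi = lo B + (s + β) * L
                    ; lo<hi = <-by _ _ (*-pos 0<β (0<length B)) (sym lemma) }

        lo≤ : lo B ≤ lo B′
        lo≤ = ≤-by (lo B) (lo B′) (*-nonneg 0≤s (<⇒≤ (0<length B)))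
          (solve 2 (λ l t → t := l :+ t :- l) refl (lo B) (s * L))

        ≤hi : hi B′ ≤ hi B
        ≤hi = ≤-by (hi B′) (hi B) (*-nonneg (x≤y⇒0≤y-x s+β≤1) (<⇒≤ (0<length B)))
          (solve 3 (λ l h t → (:1 :- t) :* (h :- l) := h :- (l :+ t :* (h :- l)))
            refl (lo B) (hi B) (s + β))

        inside : ∀ {x} → ⟦ B′ ⟧ᶜ x → ⟦ B ⟧ᶜ x × ¬ ⟦ reply v ⟧ x
        inside (lo′≤x , x≤hi′) = (≤-trans lo≤ lo′≤x , ≤-trans x≤hi′ ≤hi) , λ (left , right) →
          [ (λ hi′<gap → <⇒≱ hi′<gap (≤-trans (below⇒≤ (leftClosed (reply v)) left) x≤hi′))
          , (λ gap<lo′ → <⇒≱ gap<lo′ (≤-trans lo′≤x (below⇒≤ (rightClosed (reply v)) right)))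
          ]′ clear

      -- Strictly less than `γ`, so that after a shift `τ` of at most `w` the room `γ - τ` is still
      -- positive, as strict separation in `moveAt` demands.
      w : Carrier
      w = γ * β

      0<w : 0# < w
      0<w = *-pos 0<γ 0<β

      0<γ-τ : ∀ {τ} → τ ≤ w → 0# < γ - τ
      0<γ-τ {τ} τ≤w = <-resp₂ refl
        (solve 3 (λ g b t → g :* (:1 :- b) :+ (g :* b :- t) := g :- t) refl γ β τ)
        (+-pos-nonneg (*-pos 0<γ (x<y⇒0<y-x β<1)) (x≤y⇒0≤y-x τ≤w))

      2β≥0 : 0# ≤ β + β
      2β≥0 = +-nonneg (<⇒≤ 0<β) (<⇒≤ 0<β)

      gap⁺≈ : ∀ v → gap⁺ v ≈ gap⁻ v + β * length (I v)
      gap⁺≈ v = trans (solve 2 (λ a b → b := a :+ (b :- a)) refl (gap⁻ v) (gap⁺ v))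
                      (+-congˡ (proj₂ (reply-legal v)))

      leftmost : ∀ v → lo (I v) + β * length (I v) < gap⁻ v → Move v 0#
      leftmost v clear = moveAt v 0# ≤-refl
        (≤-resp₂ (sym (+-identityˡ β)) refl (<⇒≤ β<1))
        (inj₁ (<-resp₂ (+-congˡ (*-congʳ (sym (+-identityˡ β)))) refl clear))

      -- In relative terms Bob's interval ends at `τ + β`, which is `γ - τ` short of `1# - β - β`,
      -- where Alice's interval starts at the earliest. `nearRight` is the mirror image.
      nearLeft : ∀ v τ → 0# ≤ τ → τ ≤ w →
                 lo (I v) + (1# - β - β) * length (I v) ≤ gap⁻ v → Move v τ
      nearLeft v τ 0≤τ τ≤w clear = moveAt v τ 0≤τ
        (≤-by (τ + β) 1# (+-nonneg (<⇒≤ (0<γ-τ τ≤w)) 2β≥0)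
          (solve 2 (λ b t → :1 :- (:1 :+ :1 :+ :1) :* b :- t :+ (b :+ b) := :1 :- (t :+ b))
              refl β τ))
        (inj₁ (<-by _ _
          (+-pos-nonneg (*-pos (0<γ-τ τ≤w) (0<length (I v))) (x≤y⇒0≤y-x clear))
          (solve 5 (λ b t l L a →
            (:1 :- (:1 :+ :1 :+ :1) :* b :- t) :* L :+ (a :- (l :+ (:1 :- b :- b) :* L))
              := a :- (l :+ (t :+ b) :* L)) refl β τ (lo (I v)) (length (I v)) (gap⁻ v))))

      nearRight : ∀ v τ → 0# ≤ τ → τ ≤ w →
                  gap⁻ v ≤ lo (I v) + β * length (I v) → Move v (1# - β - τ)
      nearRight v τ 0≤τ τ≤w clear = moveAt v (1# - β - τ)
        (≤-resp₂ refl
          (solve 2 (λ b t → :1 :- (:1 :+ :1 :+ :1) :* b :- t :+ (b :+ b) := :1 :- b :- t) refl β τ)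
          (+-nonneg (<⇒≤ (0<γ-τ τ≤w)) 2β≥0))
        (≤-by _ 1# 0≤τ (solve 2 (λ b t → t := :1 :- (:1 :- b :- t :+ b)) refl β τ))
        (inj₂ (<-resp₂ (sym (gap⁺≈ v)) refl (<-by _ _
          (+-pos-nonneg (*-pos (0<γ-τ τ≤w) (0<length (I v))) (x≤y⇒0≤y-x clear))
          (solve 5 (λ b t l L a →
            (:1 :- (:1 :+ :1 :+ :1) :* b :- t) :* L :+ (l :+ b :* L :- a)
              := l :+ (:1 :- b :- t) :* L :- (a :+ b :* L)) refl β τ (lo (I v)) (length (I v)) (gap⁻ v)))))

      rightmost : ∀ v → gap⁻ v < lo (I v) + (1# - β - β) * length (I v) → Move v (1# - β - 0#)
      rightmost v clear = moveAt v (1# - β - 0#)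
        (≤-resp₂ refl (solve 1 (λ b → :1 :- b := :1 :- b :- :0) refl β) 0≤1-β)
        (≤-reflexive (solve 1 (λ b → :1 :- b :- :0 :+ b := :1) refl β))
        (inj₂ (<-resp₂ (sym (gap⁺≈ v)) refl (<-by _ _ (x<y⇒0<y-x clear)
          (solve 4 (λ b l L a → l :+ (:1 :- b :- b) :* L :- a
              := l :+ (:1 :- b :- :0) :* L :- (a :+ b :* L)) refl β (lo (I v)) (length (I v)) (gap⁻ v)))))

      someMove : ∀ v → ∃ (Move v)
      someMove v with ≤-or-> (gap⁻ v) (lo (I v) + β * length (I v))
      ... | inj₁ gap≤ = _ , nearRight v 0# ≤-refl (<⇒≤ 0<w) gap≤
      ... | inj₂ <gap = _ , leftmost v <gap

      -- No point lies in all reachable intervals.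

      module Trapped (root : Vertex) (x : Carrier)
                     (trapped : ∀ v → TransClosure _⟶_ root v → ⟦ I v ⟧ᶜ x) where

        Q : Pred Carrier 0ℓ
        Q p = ∃ λ v → TransClosure _⟶_ root v × x - lo (I v) ≈ p * length (I v)

        Q-resp : ∀ {p p′} → p ≈ p′ → Q p → Q p′
        Q-resp p≈p′ (v , r , eq) = v , r , trans eq (*-congʳ p≈p′)

        Q-bounds : ∀ p → Q p → 0# ≤ p × p ≤ 1#
        Q-bounds p (v , r , eq) =
          *-cancelˡ-≤ (0<length (I v)) (≤-resp₂ (sym (zeroʳ _)) (trans eq (*-comm _ _))
            (x≤y⇒0≤y-x (proj₁ (trapped v r)))) ,
          *-cancelˡ-≤ (0<length (I v)) (≤-resp₂ (trans eq (*-comm _ _)) (sym (*-identityʳ _))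
            (≤-by _ _ (x≤y⇒0≤y-x (proj₂ (trapped v r)))
              (solve 3 (λ x l h → h :- x := h :- l :- (x :- l)) refl x (lo (I v)) (hi (I v)))))

        module _ {v p} (r : TransClosure _⟶_ root v) (eq : x - lo (I v) ≈ p * length (I v)) where

          ℓ L : Carrier
          ℓ = lo (I v)
          L = length (I v)

          extend : ∀ {s} (m : Move v s) → TransClosure _⟶_ root (Move.next m)
          extend m = r ++ [ Move.edge m ]

          s≤p : ∀ {s} → Move v s → s ≤ p
          s≤p {s} m = *-cancelˡ-≤ (0<length (I v)) (≤-by _ _
            (x≤y⇒0≤y-x (≤-resp₂ (Move.lo≈ m) refl (proj₁ (trapped _ (extend m)))))
            (trans (solve 4 (λ x l s L → x :- (l :+ s :* L) := x :- l :- L :* s) refl x ℓ s L)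
                   (+-congʳ (trans eq (*-comm _ _)))))

          p≤s+β : ∀ {s} → Move v s → p ≤ s + β
          p≤s+β {s} m = *-cancelˡ-≤ (0<length (I v)) (≤-by _ _
            (x≤y⇒0≤y-x (≤-resp₂ refl (Move.hi≈ m) (proj₂ (trapped _ (extend m)))))
            (trans (solve 4 (λ x l t L → l :+ t :* L :- x := L :* t :- (x :- l)) refl x ℓ (s + β) L)
                   (+-congˡ (-‿cong (trans eq (*-comm _ _))))))

          -- Passing to Bob's next interval subtracts its offset from the relative position and
          -- magnifies by the inverse of `β`.
          after : ∀ {s q} → Move v s → β * q ≈ p - s → Q q
          after {s} {q} m βq≈p-s = Move.next m , extend m , (begin
            x - lo (I (Move.next m))       ≈⟨ +-congˡ (-‿cong (Move.lo≈ m)) ⟩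
            x - (ℓ + s * L)                ≈⟨ solve 4 (λ x l s L → x :- (l :+ s :* L) := x :- l :- s :* L)
                refl x ℓ s L ⟩
            x - ℓ - s * L                  ≈⟨ +-congʳ eq ⟩
            p * L - s * L                  ≈⟨ solve 3 (λ p s L → p :* L :- s :* L := (p :- s) :* L)
                refl p s L ⟩
            (p - s) * L                    ≈⟨ *-congʳ βq≈p-s ⟨
            β * q * L                      ≈⟨ solve 3 (λ b q L → b :* q :* L := q :* (b :* L))
                refl β q L ⟩
            q * (β * L)                    ≈⟨ *-congˡ (Move.length≈ m) ⟨
            q * length (I (Move.next m))   ∎)
            where open import Relation.Binary.Reasoning.Setoid setoid

        open Magnification {β} {w} 0<β 0<γ 0<w

        1-p≤β : ∀ {p} → 1# - β - 0# ≤ p → 1# - p ≤ β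
        1-p≤β {p} s≤p = ≤-by (1# - p) β (x≤y⇒0≤y-x s≤p)
          (solve 2 (λ b p → p :- (:1 :- b :- :0) := b :- (:1 :- p)) refl β p)

        -- Alice's interval starts at relative position at most `β`, at least `1# - β - β`, or in
        -- between. The first two cases leave Bob the shifted moves at the right or left end, and
        -- `x` must lie in all of them.
        Q-split : ∀ p → Q p → Near Q p ⊎ Near (mirror Q) (1# - p)
        Q-split p (v , r , eq) with ≤-or-> (gap⁻ v) (lo (I v) + β * length (I v))
        ... | inj₁ gap≤ = inj₂
                ( 1-p≤β (s≤p r eq (nearRight v 0# ≤-refl (<⇒≤ 0<w) gap≤))
                , λ τ q 0≤τ τ≤w βq≈ → after r eq (nearRight v τ 0≤τ τ≤w gap≤)
                    (trans (solve 2 (λ b q → b :* (:1 :- q) := b :- b :* q) refl β q)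
                    (trans (+-congˡ (-‿cong βq≈))
                      (solve 3 (λ b p t → b :- (:1 :- p :- t) := p :- (:1 :- b :- t))
                          refl β p τ))) )
        ... | inj₂ <gap with ≤-or-> (lo (I v) + (1# - β - β) * length (I v)) (gap⁻ v)
        ... | inj₁ clear = inj₁
                ( ≤-resp₂ refl (+-identityˡ β) (p≤s+β r eq (leftmost v <gap))
                , λ τ q 0≤τ τ≤w βq≈ → after r eq (nearLeft v τ 0≤τ τ≤w clear) βq≈ )
        -- Both extreme moves are legal here, so `x` would have relative position at most `β` and at
        -- least `1# - β`.
        ... | inj₂ clear = ⊥-elim (<⇒≱ β<1-β
                (≤-trans (≤-reflexive (solve 1 (λ b → :1 :- b := :1 :- b :- :0) refl β))
                (≤-trans (s≤p r eq (rightmost v clear))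
                (≤-resp₂ refl (+-identityˡ β) (p≤s+β r eq (leftmost v <gap))))))

        impossible : ⊥
        -- Paths are nonempty, so `root` itself does not count as reachable; the first element of
        -- `Q` comes from one arbitrary move.
        impossible = Q-empty Q Q-resp Q-bounds Q-split (p , next , [ edge ] , (begin
          x - lo (I next)                      ≈⟨ *-identityˡ _ ⟨
          1# * (x - lo (I next))               ≈⟨ *-congʳ (⁻¹-inverseʳ len (0<⇒≉0 (0<length (I next)))) ⟨
          len * len ⁻¹ * (x - lo (I next))         ≈⟨ solve 3 (λ L L⁻¹ u → L :* L⁻¹ :* u := L⁻¹ :* u :* L)
              refl len (len ⁻¹) (x - lo (I next)) ⟩
          p * len                              ∎))
          where
          open import Relation.Binary.Reasoning.Setoid setoid
          open Move (proj₂ (someMove root)) using (next; edge)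
          len = length (I next)
          p = len ⁻¹ * (x - lo (I next))

      -- If no two intervals reachable from v were disjoint, then by Helly's
      -- theorem on the line all of them would share a point.
      fork : ∀ v → ∃ λ (child : Bool → Vertex) →
             (∀ b → TransClosure _⟶_ v (child b)) ×
             DisjointFrom ⟦ I (child true) ⟧ᶜ ⟦ I (child false) ⟧ᶜ
      fork v with em {∃ λ (child : Bool → Vertex) → (∀ b → TransClosure _⟶_ v (child b)) ×
                      hi (I (child true)) < lo (I (child false))}
      ... | yes (child , path , hi<lo) = child , path ,
              λ x (_ , x≤hi) (lo≤x , _) → <⇒≱ hi<lo (≤-trans lo≤x x≤hi)
      ... | no none = ⊥-elim (Trapped.impossible v (proj₁ sup) λ u r →
              proj₁ (proj₂ sup) (lo (I u)) (u , r , refl) , proj₂ (proj₂ sup) (hi (I u)) (lo≤hi u r))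
        where
        LeftEnd : Pred Carrier 0ℓ
        LeftEnd x = ∃ λ u → TransClosure _⟶_ v u × x ≈ lo (I u)

        lo≤hi : ∀ u → TransClosure _⟶_ v u → UpperBound LeftEnd (hi (I u))
        lo≤hi u r x (u′ , r′ , x≈lo) with ≤-or-> x (hi (I u))
        ... | inj₁ x≤hi = x≤hi
        ... | inj₂ hi<x = ⊥-elim (none
                ((λ { true → u ; false → u′ }) , (λ { true → r ; false → r′ }) , <-resp₂ refl x≈lo hi<x))

        open Move (proj₂ (someMove v)) using (next; edge)

        sup = complete LeftEnd (lo (I next) , next , [ edge ] , refl) (hi (I next) , lo≤hi next [ edge ])

      open CantorScheme _⟶_ I (λ {v} {w} → shrinks {v} {w}) fork

      root : Vertex
      root = ([] , record { lo = 0# ; hi = 1# ; lo<hi = 0<1 }) , tt , tt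

      -- Each point of the Cantor set is the outcome of a play following `σ`. Alice's win puts some
      -- point of the intersection in `S`, and by uniqueness it is the given one; so the whole
      -- Cantor set would lie in `S`.
      not-winning : Bernstein S → ¬ (∀ p → AliceFollows σ p → AliceWins p)
      not-winning bernstein wins = Bernstein.containsNone bernstein (cantorSet root)
        (cantorSet-closed root) (cantorSet-uncountable root)
        λ x∈C → let path = cantorSet-path root x∈C
                    y , y∈ , y∈S = wins (playOf path) (follows path)
                    x∈ = InfinitePath.outcome path
                in  respects S (antisym (intersection-unique (playOf path) x∈ y∈)
                                        (intersection-unique (playOf path) y∈ x∈)) y∈S
        where
        module _ {x} (path : InfinitePath root x) where
          open InfinitePath path

          h : ℕ → History
          h n = proj₁ (proj₁ (vertex n))

          B : ℕ → CompactInterval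
          B n = I (vertex n)

          A : ℕ → Interval
          A n = reply (vertex n)

          history≡ : ∀ n → h n ≡ historyBefore B A n
          history≡ = historyBefore-unique B A h (≡.cong (λ v → proj₁ (proj₁ v)) start) edge

          playOf : Play
          playOf = record
            { B          = B
            ; A          = A
            ; bobLegal   = λ n → ≡.subst (λ k → BobLegal k (B n)) (history≡ n) (proj₂ (proj₂ (vertex n)))
            ; aliceLegal = λ n → reply-legal (vertex n)
            }

          follows : AliceFollows σ playOf
          follows n = ≡.subst (λ k → A n ≈ⁱ move k (B n)) (history≡ n) (≈ⁱ-refl {A n})

theorem2 : ExcludedMiddle 0ℓ →
    (R : CompleteOrderedField) →
    let open CompleteOrderedField R
        open RealLine R
        open AbsoluteGame R in
    (β : Carrier) → 0# < β → β < (1# + 1# + 1#) ⁻¹ →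
    (S : Subset) → Bernstein S →
    ¬ Determined β S
theorem2 em R β 0<β β<⅓ S bernstein =
  [ (λ (σ , wins) → AgainstAlice.not-winning σ bernstein wins)
  , (λ (τ , wins) → AgainstBob.not-winning τ bernstein wins) ]′
  where open Game.Strategies em R β 0<β β<⅓ S
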